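{- For all nonnegative integers $a,b,c$ (with $E$ taken to be $0$ whenever an argument is negative): $$2(a-b)E(a,b,c)+(a-b+c+1)E(a+1,b,c)+(a-b-c-1)E(a,b+1,c)=0,$$ $$2a\,E(a-1,b,c)+(a-b+c)E(a,b,c)+(c-a-b-1)E(a,b+1,c)=0,$$ $$(a-b)(a+b-c)E(a,b,c)+a(a-b-c-1)E(a-1,b,c)+b(a-b+c+1)E(a,b-1,c)=0,$$ $$(a-b+c+1)(a+b-c+1)E(a+1,b,c)+\big(3a^2+a-(2a+1)(b+c)-(b-c)^2\big)E(a,b,c)+2a(a-b-c-1)E(a-1,b,c)=0.$$
   Context: For nonnegative integers $n_1,\dots,n_S$, $E(n_1,\dots,n_S)$ denotes the number of block derangements: $S$ players hold $n_1,\dots,n_S$ distinct cards respectively; all $N=n_1+\dots+n_S$ cards are redealt so that player $j$ again receives exactly $n_j$ cards (only which cards each player gets matters); $E$ counts the deals in which no player receives any card he originally held. Equivalently, $E(n_1,\dots,n_S)$ is the coefficient of $x_1^{n_1}\cdots x_S^{n_S}$ in $\prod_{j=1}^S(x_1+\dots+x_S-x_j)^{n_j}$. By convention $E(0,\dots,0)=1$. -}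

module Defs where

open import Data.Fin.Base using (Fin; zero; suc)
open import Data.Fin.Properties using (_≟_; all?)
open import Data.Integer.Base as ℤ using (ℤ; +_; 0ℤ)
open import Data.List.Base as List using (List; allFin; cartesianProductWith; filter; length)
open import Data.Nat.Base using (ℕ; zero; suc)
import Data.Nat.Properties as ℕ
open import Data.Product.Base using (_×_)
open import Data.Vec.Base using (Vec; []; _∷_; _++_; count; lookup; map; replicate; sum)
open import Relation.Binary.PropositionalEquality.Core using (_≡_; _≢_)
open import Relation.Nullary.Decidable using (Dec; ¬?; _×-dec_)

-- The S players are the elements of Fin S; player j holds lookup n j cards.
-- The N = sum n cards are numbered so that player 0 holds the first block,
-- player 1 the next one, and so on; entry i of owners n is the original
-- holder of card i.
owners : ∀ {S} (n : Vec ℕ S) → Vec (Fin S) (sum n)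
owners []      = []
owners (k ∷ n) = replicate k zero ++ map suc (owners n)

-- A redistribution of the cards is the vector d whose entry i is the player
-- receiving card i, so that the order in which a player gets his cards is not
-- recorded.
IsDeal : ∀ {S} (n : Vec ℕ S) → Vec (Fin S) (sum n) → Set
IsDeal n d = ∀ j → count (_≟ j) d ≡ lookup n j

NoCardReturned : ∀ {S} (n : Vec ℕ S) → Vec (Fin S) (sum n) → Set
NoCardReturned n d = ∀ i → lookup d i ≢ lookup (owners n) i

IsBlockDerangement : ∀ {S} (n : Vec ℕ S) → Vec (Fin S) (sum n) → Set
IsBlockDerangement n d = IsDeal n d × NoCardReturned n d

isBlockDerangement? : ∀ {S} (n : Vec ℕ S) d → Dec (IsBlockDerangement n d)
isBlockDerangement? n d =
  all? (λ j → count (_≟ j) d ℕ.≟ lookup n j)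
  ×-dec
  all? (λ i → ¬? (lookup d i ≟ lookup (owners n) i))

-- Every vector of length m over Fin S, each listed exactly once.
allVecs : ∀ S m → List (Vec (Fin S) m)
allVecs S zero    = List.[ [] ]
allVecs S (suc m) = cartesianProductWith _∷_ (allFin S) (allVecs S m)

blockDerangements : ∀ {S} (n : Vec ℕ S) → List (Vec (Fin S) (sum n))
blockDerangements {S} n = filter (isBlockDerangement? n) (allVecs S (sum n))

#E : ∀ {S} → Vec ℕ S → ℕ
#E n = length (blockDerangements n)

-- The number of block derangements for three players, extended by 0 to
-- triples with a negative entry.
E : ℤ → ℤ → ℤ → ℤ
E (+ a) (+ b) (+ c) = + #E (a ∷ b ∷ c ∷ [])
E _     _     _     = 0ℤ

{-# OPTIONS --safe #-}
-- Write L₁ = y+z, L₂ = x+z, L₃ = x+y, so that E(a,b,c) is the coefficient of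
-- xᵃyᵇzᶜ in L₁ᵃL₂ᵇL₃ᶜ.  The identity L₁L₂L₃ = xyL₃ + yzL₁ + zxL₂ + 2xyz says
-- that E satisfies the recurrence encoded by
-- D · Σ E(a,b,c)xᵃyᵇzᶜ = 1, where D = 1 - xy - yz - zx - 2xyz.  The left-hand
-- sides of the first two identities come from this series F by first-order
-- operators: the first is L F with L a vector field annihilating D, the second
-- is (L + 2x) F with L D = 2xD.  Either way its product with D is L 1 = 0 (up to
-- terms with vanishing weight), so it is 0; likewise for E(a,b,c) - E(b,a,c).
-- The last two identities are linear combinations of the first two and of the
-- second with a and b exchanged.
module Submission where

open import Defs
open import Data.Fin.Base using (Fin; zero; suc)
open import Data.Fin.Patterns using (0F; 1F; 2F)
open import Data.Fin.Properties using (_≟_; all?)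
open import Data.Integer.Base using (ℤ; +_; -[1+_]; 0ℤ; 1ℤ; -1ℤ; _+_; _-_; _*_; _^_)
import Data.Integer.Properties as ℤ
open import Data.Integer.Tactic.RingSolver using (solve-∀)
open import Data.List.Base as List using (_++_; length; filter)
import Data.List.Properties as List
import Data.List.Relation.Unary.All as All
import Data.List.Relation.Unary.All.Properties as All
open import Data.Nat.Base as ℕ using (ℕ; zero; suc)
import Data.Nat.Properties as ℕ
open import Data.Product.Base using (_×_; _,_; proj₂)
open import Data.Sum.Base using (_⊎_; inj₁; inj₂)
open import Data.Vec.Base using (Vec; []; _∷_; count; lookup)
open import Function.Bundles using (_⇔_; mk⇔; module Equivalence)
open import Function.Base using (_∘_)
open import Level using (Level)
open import Relation.Binary.PropositionalEquality
  using (_≡_; _≢_; refl; sym; trans; cong; cong₂; subst; module ≡-Reasoning)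
open import Relation.Nullary using (¬_; yes; no; contradiction)
open import Relation.Nullary.Decidable using (¬?; _×-dec_)
open import Relation.Unary using (Pred; Decidable)

private
  variable
    ℓ : Level
    m : ℕ

-- Counting deals

module _ {A B : Set} {P : Pred B ℓ} (P? : Decidable P) (g : A → B) where

  length-filter-map : {Q : Pred A ℓ} (Q? : Decidable Q) → (∀ x → P (g x) ⇔ Q x) →
    ∀ xs → length (filter P? (List.map g xs)) ≡ length (filter Q? xs)
  length-filter-map Q? eqv List.[] = refl
  length-filter-map Q? eqv (x List.∷ xs) with P? (g x) | Q? x
  ... | yes p | yes q = cong suc (length-filter-map Q? eqv xs)
  ... | no ¬p | no ¬q = length-filter-map Q? eqv xs
  ... | yes p | no ¬q = contradiction (Equivalence.to (eqv x) p) ¬q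
  ... | no ¬p | yes q = contradiction (Equivalence.from (eqv x) q) ¬p

  length-filter-map-none : (∀ x → ¬ P (g x)) →
    ∀ xs → length (filter P? (List.map g xs)) ≡ 0
  length-filter-map-none none xs =
    cong length (List.filter-none P? (All.map⁺ (All.universal none xs)))

-- The counts are integers so that dealing one card to a player subtracts `1ℤ` with no case split; a
-- negative count is simply never attained.
HasContent : ℤ → ℤ → ℤ → Vec (Fin 3) m → Set
HasContent a b c d =
  + count (_≟ 0F) d ≡ a × + count (_≟ 1F) d ≡ b × + count (_≟ 2F) d ≡ c

Avoids : Vec (Fin 3) m → Vec (Fin 3) m → Set
Avoids os d = ∀ i → lookup d i ≢ lookup os i

-- Unlike in `IsBlockDerangement`, the counts are independent of the owners, which allows an
-- induction on the cards.
Valid : Vec (Fin 3) m → ℤ → ℤ → ℤ → Vec (Fin 3) m → Set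
Valid os a b c d = HasContent a b c d × Avoids os d

valid? : ∀ (os : Vec (Fin 3) m) a b c → Decidable (Valid os a b c)
valid? os a b c d =
  ((_ ℤ.≟ a) ×-dec (_ ℤ.≟ b) ×-dec (_ ℤ.≟ c))
  ×-dec all? (λ i → ¬? (lookup d i ≟ lookup os i))

deals : Vec (Fin 3) m → ℤ → ℤ → ℤ → ℤ
deals {m} os a b c = + length (filter (valid? os a b c) (allVecs 3 m))

1+[i-1]≡i : ∀ i → 1ℤ + (i - 1ℤ) ≡ i
1+[i-1]≡i = solve-∀

+suc≡⇒ : ∀ n {i} → + suc n ≡ i → + n ≡ i - 1ℤ
+suc≡⇒ n refl = refl

⇒+suc≡ : ∀ n {i} → + n ≡ i - 1ℤ → + suc n ≡ i
⇒+suc≡ n {i} eq = trans (cong (_+_ 1ℤ) eq) (1+[i-1]≡i i)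

content-0 : ∀ a b c (d : Vec (Fin 3) m) → HasContent a b c (0F ∷ d) ⇔ HasContent (a - 1ℤ) b c d
content-0 a b c d = mk⇔ (λ (p , q , r) → +suc≡⇒ _ p , q , r) (λ (p , q , r) → ⇒+suc≡ _ p , q , r)

content-1 : ∀ a b c (d : Vec (Fin 3) m) → HasContent a b c (1F ∷ d) ⇔ HasContent a (b - 1ℤ) c d
content-1 a b c d = mk⇔ (λ (p , q , r) → p , +suc≡⇒ _ q , r) (λ (p , q , r) → p , ⇒+suc≡ _ q , r)

content-2 : ∀ a b c (d : Vec (Fin 3) m) → HasContent a b c (2F ∷ d) ⇔ HasContent a b (c - 1ℤ) d
content-2 a b c d = mk⇔ (λ (p , q , r) → p , q , +suc≡⇒ _ r) (λ (p , q , r) → p , q , ⇒+suc≡ _ r)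

startingWith : Fin 3 → Vec (Fin 3) (suc m) → ℤ → ℤ → ℤ → ℤ
startingWith {m} x os a b c =
  + length (filter (valid? os a b c) (List.map (x ∷_) (allVecs 3 m)))

startingWith-owner : ∀ o (os : Vec (Fin 3) m) a b c → startingWith o (o ∷ os) a b c ≡ 0ℤ
startingWith-owner o os a b c = cong +_
  (length-filter-map-none (valid? (o ∷ os) a b c) (o ∷_) (λ d v → proj₂ v 0F refl) (allVecs 3 _))

startingWith-other : ∀ {x o} (os : Vec (Fin 3) m) a b c {a′ b′ c′} → x ≢ o →
  (∀ d → HasContent a b c (x ∷ d) ⇔ HasContent a′ b′ c′ d) →
  startingWith x (o ∷ os) a b c ≡ deals os a′ b′ c′
startingWith-other {x = x} {o} os a b c {a′} {b′} {c′} x≢o eqv = cong +_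
  (length-filter-map (valid? (o ∷ os) a b c) (x ∷_) (valid? os a′ b′ c′)
    (λ d → mk⇔
      (λ (h , v) → Equivalence.to (eqv d) h , v ∘ suc)
      (λ (h , v) → Equivalence.from (eqv d) h , λ { zero → x≢o ; (suc i) → v i }))
    (allVecs 3 _))

deals-∷ : ∀ o (os : Vec (Fin 3) m) a b c → deals (o ∷ os) a b c ≡
  startingWith 0F (o ∷ os) a b c + startingWith 1F (o ∷ os) a b c + startingWith 2F (o ∷ os) a b c
deals-∷ {m} o os a b c = begin
  + length (filter P? (xs ++ ys ++ zs ++ List.[]))
    -- `allVecs 3 (suc m)` unfolds to one block for each recipient of the first card, followed by an
    -- empty list.
    ≡⟨ cong (λ vs → + length (filter P? (xs ++ ys ++ vs))) (List.++-identityʳ zs) ⟩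
  + length (filter P? (xs ++ ys ++ zs))
    ≡⟨ cong +_ (trans (split xs (ys ++ zs)) (cong (length (filter P? xs) ℕ.+_) (split ys zs))) ⟩
  + (length (filter P? xs) ℕ.+ (length (filter P? ys) ℕ.+ length (filter P? zs)))
    ≡⟨ cong +_ (ℕ.+-assoc (length (filter P? xs)) _ _) ⟨
  + (length (filter P? xs) ℕ.+ length (filter P? ys) ℕ.+ length (filter P? zs)) ∎
  where
  open ≡-Reasoning
  P? = valid? (o ∷ os) a b c
  xs = List.map (0F ∷_) (allVecs 3 m)
  ys = List.map (1F ∷_) (allVecs 3 m)
  zs = List.map (2F ∷_) (allVecs 3 m)
  split : ∀ us vs → length (filter P? (us ++ vs)) ≡ length (filter P? us) ℕ.+ length (filter P? vs)
  split us vs = trans (cong length (List.filter-++ P? us vs)) (List.length-++ (filter P? us))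

-- Coefficients of L₁ᵃL₂ᵇL₃ᶜ

-- A function of this type is a Laurent series in x, y, z given by its
-- coefficients, and step o multiplies it by the sum of the two variables other
-- than that of player o.
Series : Set
Series = ℤ → ℤ → ℤ → ℤ

step : Fin 3 → Series → Series
step 0F f a b c = f a (b - 1ℤ) c + f a b (c - 1ℤ)
step 1F f a b c = f (a - 1ℤ) b c + f a b (c - 1ℤ)
step 2F f a b c = f (a - 1ℤ) b c + f a (b - 1ℤ) c

one : Series
one (+ 0) (+ 0) (+ 0) = 1ℤ
one _     _     _     = 0ℤ

-- Each card contributes the linear form of its owner, so this is the product of these forms over
-- all cards.
coeff : Vec (Fin 3) m → Series
coeff []       = one
coeff (o ∷ os) = step o (coeff os)

infix 4 _≗₃_
_≗₃_ : Series → Series → Set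
f ≗₃ g = ∀ a b c → f a b c ≡ g a b c

step-cong : ∀ o {f g} → f ≗₃ g → step o f ≗₃ step o g
step-cong 0F eq a b c = cong₂ _+_ (eq _ _ _) (eq _ _ _)
step-cong 1F eq a b c = cong₂ _+_ (eq _ _ _) (eq _ _ _)
step-cong 2F eq a b c = cong₂ _+_ (eq _ _ _) (eq _ _ _)

interchange : ∀ p q r s → p + q + (r + s) ≡ p + r + (q + s)
interchange = solve-∀

step-comm : ∀ o o′ f → step o (step o′ f) ≗₃ step o′ (step o f)
step-comm 0F 0F f a b c = refl
step-comm 0F 1F f a b c = interchange (f (a - 1ℤ) (b - 1ℤ) c) _ _ _
step-comm 0F 2F f a b c = interchange (f (a - 1ℤ) (b - 1ℤ) c) _ _ _
step-comm 1F 0F f a b c = interchange (f (a - 1ℤ) (b - 1ℤ) c) _ _ _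
step-comm 1F 1F f a b c = refl
step-comm 1F 2F f a b c = interchange (f (a - 1ℤ - 1ℤ) b c) _ _ _
step-comm 2F 0F f a b c = interchange (f (a - 1ℤ) (b - 1ℤ) c) _ _ _
step-comm 2F 1F f a b c = interchange (f (a - 1ℤ - 1ℤ) b c) _ _ _
step-comm 2F 2F f a b c = refl

-- Induction on the cards: the first card cannot go to its owner, and giving it to either other
-- player lowers that player's count by one. These two choices are the two summands of `step`.
deals≡coeff : (os : Vec (Fin 3) m) → deals os ≗₃ coeff os
deals≡coeff [] (+ zero) (+ zero) (+ zero) = refl
deals≡coeff [] (+ zero) (+ zero) (+ suc c) = refl
deals≡coeff [] (+ zero) (+ zero) -[1+ c ] = refl
deals≡coeff [] (+ zero) (+ suc b) c = refl
deals≡coeff [] (+ zero) -[1+ b ] c = refl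
deals≡coeff [] (+ suc a) b c = refl
deals≡coeff [] -[1+ a ] b c = refl
deals≡coeff (0F ∷ os) a b c = trans (deals-∷ 0F os a b c) (cong₂ _+_
  (trans (cong₂ _+_ (startingWith-owner 0F os a b c)
                    (startingWith-other os a b c (λ ()) (content-1 a b c)))
         (trans (ℤ.+-identityˡ _) (deals≡coeff os _ _ _)))
  (trans (startingWith-other os a b c (λ ()) (content-2 a b c)) (deals≡coeff os _ _ _)))
deals≡coeff (1F ∷ os) a b c = trans (deals-∷ 1F os a b c) (cong₂ _+_
  (trans (cong₂ _+_ (startingWith-other os a b c (λ ()) (content-0 a b c))
                    (startingWith-owner 1F os a b c))
         (trans (ℤ.+-identityʳ _) (deals≡coeff os _ _ _)))
  (trans (startingWith-other os a b c (λ ()) (content-2 a b c)) (deals≡coeff os _ _ _)))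
deals≡coeff (2F ∷ os) a b c = trans (deals-∷ 2F os a b c) (trans (cong₂ _+_
  (cong₂ _+_
    (trans (startingWith-other os a b c (λ ()) (content-0 a b c)) (deals≡coeff os _ _ _))
    (trans (startingWith-other os a b c (λ ()) (content-1 a b c)) (deals≡coeff os _ _ _)))
  (startingWith-owner 2F os a b c)) (ℤ.+-identityʳ _))

power : ℕ → ℕ → ℕ → Series
power a b c = coeff (owners (a ∷ b ∷ c ∷ []))

E≡power : ∀ a b c → E (+ a) (+ b) (+ c) ≡ power a b c (+ a) (+ b) (+ c)
E≡power a b c = trans
  (cong (+_ ∘ length) (List.filter-≐ (isBlockDerangement? n) (valid? (owners n) (+ a) (+ b) (+ c))
    ( (λ (h , v) → (cong +_ (h 0F) , cong +_ (h 1F) , cong +_ (h 2F)) , v)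
    , (λ ((p , q , r) , v) →
        (λ { 0F → ℤ.+-injective p ; 1F → ℤ.+-injective q ; 2F → ℤ.+-injective r }) , v))
    (allVecs 3 _)))
  (deals≡coeff (owners n) (+ a) (+ b) (+ c))
  where n = a ∷ b ∷ c ∷ []

-- In `owners` the cards of player `0F` come first, so a new factor of player `1F` sits beneath
-- theirs and is moved outwards by commutativity.
power-suc₂ : ∀ a b c → power a (suc b) c ≗₃ step 1F (power a b c)
power-suc₂ zero    b c x y z = refl
power-suc₂ (suc a) b c x y z =
  trans (step-cong 0F (power-suc₂ a b c) x y z) (step-comm 0F 1F (power a b c) x y z)

power-suc₃ : ∀ a b c → power a b (suc c) ≗₃ step 2F (power a b c)
power-suc₃ zero    zero    c x y z = refl
power-suc₃ zero    (suc b) c x y z =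
  trans (step-cong 1F (power-suc₃ zero b c) x y z) (step-comm 1F 2F (power zero b c) x y z)
power-suc₃ (suc a) b       c x y z =
  trans (step-cong 0F (power-suc₃ a b c) x y z) (step-comm 0F 2F (power a b c) x y z)

-- A polynomial has no negative exponents: `one` has none, and `step` reads only coefficients at
-- equal or lower exponents.
coeff-neg₁ : ∀ (os : Vec (Fin 3) m) n b c → coeff os -[1+ n ] b c ≡ 0ℤ
coeff-neg₁ []        n b c = refl
coeff-neg₁ (0F ∷ os) n b c = cong₂ _+_ (coeff-neg₁ os _ _ _) (coeff-neg₁ os _ _ _)
coeff-neg₁ (1F ∷ os) n b c = cong₂ _+_ (coeff-neg₁ os _ _ _) (coeff-neg₁ os _ _ _)
coeff-neg₁ (2F ∷ os) n b c = cong₂ _+_ (coeff-neg₁ os _ _ _) (coeff-neg₁ os _ _ _)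

coeff-neg₂ : ∀ (os : Vec (Fin 3) m) a n c → coeff os a -[1+ n ] c ≡ 0ℤ
coeff-neg₂ []        (+ zero)  n c = refl
coeff-neg₂ []        (+ suc _) n c = refl
coeff-neg₂ []        -[1+ _ ]  n c = refl
coeff-neg₂ (0F ∷ os) a n c = cong₂ _+_ (coeff-neg₂ os a _ _) (coeff-neg₂ os a _ _)
coeff-neg₂ (1F ∷ os) a n c = cong₂ _+_ (coeff-neg₂ os _ _ _) (coeff-neg₂ os a _ _)
coeff-neg₂ (2F ∷ os) a n c = cong₂ _+_ (coeff-neg₂ os _ _ _) (coeff-neg₂ os a _ _)

coeff-neg₃ : ∀ (os : Vec (Fin 3) m) a b n → coeff os a b -[1+ n ] ≡ 0ℤ
coeff-neg₃ []        (+ zero)  (+ zero)  n = refl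
coeff-neg₃ []        (+ zero)  (+ suc _) n = refl
coeff-neg₃ []        (+ zero)  -[1+ _ ]  n = refl
coeff-neg₃ []        (+ suc _) b n = refl
coeff-neg₃ []        -[1+ _ ]  b n = refl
coeff-neg₃ (0F ∷ os) a b n = cong₂ _+_ (coeff-neg₃ os a _ _) (coeff-neg₃ os a b _)
coeff-neg₃ (1F ∷ os) a b n = cong₂ _+_ (coeff-neg₃ os _ b _) (coeff-neg₃ os a b _)
coeff-neg₃ (2F ∷ os) a b n = cong₂ _+_ (coeff-neg₃ os _ b _) (coeff-neg₃ os a _ _)

E-neg₂ : ∀ a n c → E a -[1+ n ] c ≡ 0ℤ
E-neg₂ (+ _)    n c = refl
E-neg₂ -[1+ _ ] n c = refl

E-neg₃ : ∀ a b n → E a b -[1+ n ] ≡ 0ℤ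
E-neg₃ (+ _)    (+ _)    n = refl
E-neg₃ (+ _)    -[1+ _ ] n = refl
E-neg₃ -[1+ _ ] b        n = refl

-- The recurrence

-- The coefficient of xᵖ⁺¹yᵠ⁺¹zʳ⁺¹ in (1 - xy - yz - zx - 2xyz) · f.
defect : Series → Series
defect f p q r =
  f (p + 1ℤ) (q + 1ℤ) (r + 1ℤ) - f p q (r + 1ℤ) - f (p + 1ℤ) q r - f p (q + 1ℤ) r - + 2 * f p q r

E-suc-suc-suc : ∀ a b c → E (+ suc a) (+ suc b) (+ suc c) ≡
  E (+ a) (+ b) (+ suc c) + E (+ suc a) (+ b) (+ c) + E (+ a) (+ suc b) (+ c) + + 2 * E (+ a) (+ b) (+ c)
E-suc-suc-suc a b c = begin
  E (+ suc a) (+ suc b) (+ suc c)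
    ≡⟨ E≡power (suc a) (suc b) (suc c) ⟩
  step 0F (power a (suc b) (suc c)) (+ suc a) (+ suc b) (+ suc c)
    ≡⟨ step-cong 0F (λ x y z → trans (power-suc₂ a b (suc c) x y z)
         (step-cong 1F (power-suc₃ a b c) x y z)) (+ suc a) (+ suc b) (+ suc c) ⟩
  step 0F (step 1F (step 2F Q)) (+ suc a) (+ suc b) (+ suc c)
    -- The seven values of `Q` belong to the seven monomials of L₁L₂L₃; that of xyz has coefficient
    -- 2.
    ≡⟨ rearrange (Q (+ a - 1ℤ) (+ b) (+ suc c)) (Q (+ a) (+ b - 1ℤ) (+ suc c)) (Q (+ a) (+ b) (+ c))
         (Q (+ suc a) (+ b - 1ℤ) (+ c)) (Q (+ a - 1ℤ) (+ suc b) (+ c))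
         (Q (+ a) (+ suc b) (+ c - 1ℤ)) (Q (+ suc a) (+ b) (+ c - 1ℤ)) ⟩
  step 2F Q (+ a) (+ b) (+ suc c) + step 0F Q (+ suc a) (+ b) (+ c)
    + step 1F Q (+ a) (+ suc b) (+ c) + + 2 * Q (+ a) (+ b) (+ c)
    ≡⟨ cong₂ _+_ (cong₂ _+_ (cong₂ _+_
         (trans (E≡power a b (suc c)) (power-suc₃ a b c _ _ _))
         (E≡power (suc a) b c))
         (trans (E≡power a (suc b) c) (power-suc₂ a b c _ _ _)))
         (cong (+ 2 *_) (E≡power a b c)) ⟨
  E (+ a) (+ b) (+ suc c) + E (+ suc a) (+ b) (+ c) + E (+ a) (+ suc b) (+ c) + + 2 * E (+ a) (+ b) (+ c) ∎
  where
  open ≡-Reasoning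
  Q = power a b c
  rearrange : ∀ s t u v w x y →
    (s + t + (u + v)) + (w + u + (x + y)) ≡ s + t + (v + y) + (w + x) + + 2 * u
  rearrange = solve-∀

-- When only one player holds cards, his linear form lacks his own variable, so no power of that
-- variable alone occurs.
E-0-0-suc : ∀ c → E (+ 0) (+ 0) (+ suc c) ≡ 0ℤ
E-0-0-suc c = trans (E≡power 0 0 (suc c))
  (cong₂ _+_ (coeff-neg₁ (owners (0 ∷ 0 ∷ c ∷ [])) _ _ _)
             (coeff-neg₂ (owners (0 ∷ 0 ∷ c ∷ [])) (+ 0) _ _))

E-0-suc-0 : ∀ b → E (+ 0) (+ suc b) (+ 0) ≡ 0ℤ
E-0-suc-0 b = trans (E≡power 0 (suc b) 0)
  (cong₂ _+_ (coeff-neg₁ (owners (0 ∷ b ∷ 0 ∷ [])) _ _ _)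
             (coeff-neg₃ (owners (0 ∷ b ∷ 0 ∷ [])) (+ 0) (+ suc b) _))

E-suc-0-0 : ∀ a → E (+ suc a) (+ 0) (+ 0) ≡ 0ℤ
E-suc-0-0 a = trans (E≡power (suc a) 0 0)
  (cong₂ _+_ (coeff-neg₂ (owners (a ∷ 0 ∷ 0 ∷ [])) (+ suc a) _ _)
             (coeff-neg₃ (owners (a ∷ 0 ∷ 0 ∷ [])) (+ suc a) (+ 0) _))

-- As x must not occur, one factor L₂ can only contribute z and one factor L₃ only y; removing both
-- leaves the smaller instance.
E-0-suc-suc : ∀ b c → E (+ 0) (+ suc b) (+ suc c) ≡ E (+ 0) (+ b) (+ c)
E-0-suc-suc b c = begin
  E (+ 0) (+ suc b) (+ suc c)
    ≡⟨ E≡power 0 (suc b) (suc c) ⟩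
  power 0 b (suc c) -1ℤ (+ suc b) (+ suc c) + power 0 b (suc c) (+ 0) (+ suc b) (+ c)
    ≡⟨ cong₂ _+_ (coeff-neg₁ (owners (0 ∷ b ∷ suc c ∷ [])) _ _ _) (power-suc₃ 0 b c _ _ _) ⟩
  0ℤ + (power 0 b c -1ℤ (+ suc b) (+ c) + power 0 b c (+ 0) (+ b) (+ c))
    ≡⟨ trans (ℤ.+-identityˡ _)
         (cong₂ _+_ (coeff-neg₁ (owners (0 ∷ b ∷ c ∷ [])) _ _ _) (sym (E≡power 0 b c))) ⟩
  0ℤ + E (+ 0) (+ b) (+ c)
    ≡⟨ ℤ.+-identityˡ _ ⟩
  E (+ 0) (+ b) (+ c) ∎
  where open ≡-Reasoning

E-suc-0-suc : ∀ a c → E (+ suc a) (+ 0) (+ suc c) ≡ E (+ a) (+ 0) (+ c)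
E-suc-0-suc a c = begin
  E (+ suc a) (+ 0) (+ suc c)
    ≡⟨ E≡power (suc a) 0 (suc c) ⟩
  power a 0 (suc c) (+ suc a) -1ℤ (+ suc c) + power a 0 (suc c) (+ suc a) (+ 0) (+ c)
    ≡⟨ cong₂ _+_ (coeff-neg₂ (owners (a ∷ 0 ∷ suc c ∷ [])) (+ suc a) _ _) (power-suc₃ a 0 c _ _ _) ⟩
  0ℤ + (power a 0 c (+ a) (+ 0) (+ c) + power a 0 c (+ suc a) -1ℤ (+ c))
    ≡⟨ trans (ℤ.+-identityˡ _)
         (cong₂ _+_ (sym (E≡power a 0 c)) (coeff-neg₂ (owners (a ∷ 0 ∷ c ∷ [])) (+ suc a) _ _)) ⟩
  E (+ a) (+ 0) (+ c) + 0ℤ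
    ≡⟨ ℤ.+-identityʳ _ ⟩
  E (+ a) (+ 0) (+ c) ∎
  where open ≡-Reasoning

E-suc-suc-0 : ∀ a b → E (+ suc a) (+ suc b) (+ 0) ≡ E (+ a) (+ b) (+ 0)
E-suc-suc-0 a b = begin
  E (+ suc a) (+ suc b) (+ 0)
    ≡⟨ E≡power (suc a) (suc b) 0 ⟩
  power a (suc b) 0 (+ suc a) (+ b) (+ 0) + power a (suc b) 0 (+ suc a) (+ suc b) -1ℤ
    ≡⟨ cong₂ _+_ (power-suc₂ a b 0 _ _ _)
         (coeff-neg₃ (owners (a ∷ suc b ∷ 0 ∷ [])) (+ suc a) (+ suc b) _) ⟩
  power a b 0 (+ a) (+ b) (+ 0) + power a b 0 (+ suc a) (+ b) -1ℤ + 0ℤ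
    ≡⟨ trans (ℤ.+-identityʳ _)
         (cong₂ _+_ (sym (E≡power a b 0)) (coeff-neg₃ (owners (a ∷ b ∷ 0 ∷ [])) (+ suc a) (+ b) _)) ⟩
  E (+ a) (+ b) (+ 0) + 0ℤ
    ≡⟨ ℤ.+-identityʳ _ ⟩
  E (+ a) (+ b) (+ 0) ∎
  where open ≡-Reasoning

-- The excluded triple is the constant term, where D · F has coefficient 1. Indices have the form
-- `1ℤ + p` because this computes on constructors, whereas `p + 1ℤ` is stuck on `+ a`.
E-recurrence-suc : ∀ p q r → (p ≡ -1ℤ × q ≡ -1ℤ × r ≡ -1ℤ) ⊎
  E (1ℤ + p) (1ℤ + q) (1ℤ + r) ≡
    E p q (1ℤ + r) + E (1ℤ + p) q r + E p (1ℤ + q) r + + 2 * E p q r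
E-recurrence-suc -[1+ suc n ] q r = inj₂ refl
E-recurrence-suc p -[1+ suc n ] r
  rewrite E-neg₂ (1ℤ + p) n (1ℤ + r) | E-neg₂ p (suc n) (1ℤ + r) | E-neg₂ (1ℤ + p) (suc n) r
        | E-neg₂ p n r | E-neg₂ p (suc n) r = inj₂ refl
E-recurrence-suc p q -[1+ suc n ]
  rewrite E-neg₃ (1ℤ + p) (1ℤ + q) n | E-neg₃ p q n | E-neg₃ (1ℤ + p) q (suc n)
        | E-neg₃ p (1ℤ + q) (suc n) | E-neg₃ p q (suc n) = inj₂ refl
E-recurrence-suc -[1+ zero ] -[1+ zero ] -[1+ zero ] = inj₁ (refl , refl , refl)
E-recurrence-suc -[1+ zero ] -[1+ zero ] (+ c) = inj₂ (E-0-0-suc c)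
E-recurrence-suc -[1+ zero ] (+ b) -[1+ zero ] = inj₂ (E-0-suc-0 b)
E-recurrence-suc (+ a) -[1+ zero ] -[1+ zero ] = inj₂ (E-suc-0-0 a)
E-recurrence-suc -[1+ zero ] (+ b) (+ c) = inj₂ (trans (E-0-suc-suc b c) (pad (E (+ 0) (+ b) (+ c))))
  where
  pad : ∀ i → i ≡ 0ℤ + i + 0ℤ + 0ℤ
  pad = solve-∀
E-recurrence-suc (+ a) -[1+ zero ] (+ c) = inj₂ (trans (E-suc-0-suc a c) (pad (E (+ a) (+ 0) (+ c))))
  where
  pad : ∀ i → i ≡ 0ℤ + 0ℤ + i + 0ℤ
  pad = solve-∀
E-recurrence-suc (+ a) (+ b) -[1+ zero ] = inj₂ (trans (E-suc-suc-0 a b) (pad (E (+ a) (+ b) (+ 0))))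
  where
  pad : ∀ i → i ≡ i + 0ℤ + 0ℤ + 0ℤ
  pad = solve-∀
E-recurrence-suc (+ a) (+ b) (+ c) = inj₂ (E-suc-suc-suc a b c)

E-recurrence : ∀ p q r → (p ≡ -1ℤ × q ≡ -1ℤ × r ≡ -1ℤ) ⊎ defect E p q r ≡ 0ℤ
E-recurrence p q r with E-recurrence-suc p q r
... | inj₁ p,q,r≡-1 = inj₁ p,q,r≡-1
... | inj₂ eq rewrite ℤ.+-comm p 1ℤ | ℤ.+-comm q 1ℤ | ℤ.+-comm r 1ℤ | eq =
  inj₂ (cancel (E p q (1ℤ + r)) (E (1ℤ + p) q r) (E p (1ℤ + q) r) (E p q r))
  where
  cancel : ∀ s t u v → s + t + u + + 2 * v - s - t - u - + 2 * v ≡ 0ℤ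
  cancel = solve-∀

-- As D · F = 1, only the constant term can violate the recurrence, and a weight vanishing there
-- removes it. Such weights arise because a derivation kills constants.
weighted-recurrence : ∀ (k : Series) → k -1ℤ -1ℤ -1ℤ ≡ 0ℤ →
  ∀ p q r → k p q r * defect E p q r ≡ 0ℤ
weighted-recurrence k k≡0 p q r with E-recurrence p q r
... | inj₁ (refl , refl , refl) = cong (_* defect E -1ℤ -1ℤ -1ℤ) k≡0
... | inj₂ eq = trans (cong (k p q r *_) eq) (ℤ.*-zeroʳ (k p q r))

-- The base stops at -2: the relations below involve values shifted up by one, so at -1 they can
-- still contain values of `E` at 0.
ℤ-induction : (P : ℤ → Set) → (∀ n → P -[1+ suc n ]) → (∀ p → P p → P (p + 1ℤ)) → ∀ a → P a
ℤ-induction P base next -[1+ suc n ] = base n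
ℤ-induction P base next -[1+ zero ]  = next -[1+ 1 ] (base 0)
ℤ-induction P base next (+ zero)     = next -[1+ 0 ] (next -[1+ 1 ] (base 0))
ℤ-induction P base next (+ suc n)    =
  subst (P ∘ +_) (ℕ.+-comm n 1) (next (+ n) (ℤ-induction P base next (+ n)))

-- D has constant term 1, and each of its other monomials contains x or y. Hence a series killed by
-- D is determined by its values at smaller first or second index. The third index stays universally
-- quantified and needs no base case.
vanishing : ∀ f → (∀ p q r → defect f p q r ≡ 0ℤ) →
  (∀ n b c → f -[1+ suc n ] b c ≡ 0ℤ) → (∀ a n c → f a -[1+ suc n ] c ≡ 0ℤ) →
  ∀ a b c → f a b c ≡ 0ℤ
vanishing f rec base₁ base₂ = ℤ-induction (λ a → ∀ b c → f a b c ≡ 0ℤ) base₁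
  λ p ihp → ℤ-induction (λ b → ∀ c → f (p + 1ℤ) b c ≡ 0ℤ) (base₂ (p + 1ℤ))
    λ q ihq c → subst (λ c → f (p + 1ℤ) (q + 1ℤ) c ≡ 0ℤ)
      (trans (ℤ.+-comm (c - 1ℤ) 1ℤ) (1+[i-1]≡i c))
      (next _ (ihp q _) (ihq _) (ihp (q + 1ℤ) _) (ihp q _) (rec p q (c - 1ℤ)))
  where
  identity : ∀ s → s - 0ℤ - 0ℤ - 0ℤ - + 2 * 0ℤ ≡ s
  identity = solve-∀
  next : ∀ s {t u v w} → t ≡ 0ℤ → u ≡ 0ℤ → v ≡ 0ℤ → w ≡ 0ℤ →
    s - t - u - v - + 2 * w ≡ 0ℤ → s ≡ 0ℤ
  next s refl refl refl refl eq = trans (sym (identity s)) eq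

-- The contiguity relations

-- D is symmetric in x and y, so D kills the difference of the two series; at the constant term the
-- contributions 1 and 1 cancel.
E-comm : ∀ a b c → E a b c ≡ E b a c
E-comm a b c = ℤ.i-j≡0⇒i≡j _ _ (vanishing f recurrence base₁ base₂ a b c)
  where
  f : Series
  f a b c = E a b c - E b a c
  -- Exchanging the first two indices swaps the yz and zx terms, hence `v′` before `u′`.
  split : ∀ s s′ t t′ u u′ v v′ w w′ →
    (s - s′) - (t - t′) - (u - u′) - (v - v′) - + 2 * (w - w′)
      ≡ (s - t - u - v - + 2 * w) - (s′ - t′ - v′ - u′ - + 2 * w′)
  split = solve-∀
  recurrence : ∀ p q r → defect f p q r ≡ 0ℤ
  recurrence p q r with E-recurrence p q r | E-recurrence q p r
  ... | inj₁ (refl , refl , refl) | _ = refl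
  ... | inj₂ _ | inj₁ (refl , refl , refl) = refl
  ... | inj₂ eq | inj₂ eq′ = trans
    (split (E (p + 1ℤ) (q + 1ℤ) (r + 1ℤ)) (E (q + 1ℤ) (p + 1ℤ) (r + 1ℤ))
           (E p q (r + 1ℤ)) (E q p (r + 1ℤ)) (E (p + 1ℤ) q r) (E q (p + 1ℤ) r)
           (E p (q + 1ℤ) r) (E (q + 1ℤ) p r) (E p q r) (E q p r))
    (cong₂ _-_ eq eq′)
  base₁ : ∀ n b c → f -[1+ suc n ] b c ≡ 0ℤ
  base₁ n b c rewrite E-neg₂ b (suc n) c = refl
  base₂ : ∀ a n c → f a -[1+ suc n ] c ≡ 0ℤ
  base₂ a n c rewrite E-neg₂ a (suc n) c = refl

combine-zeros : ∀ k l m → k * 0ℤ + l * 0ℤ + m * 0ℤ ≡ 0ℤ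
combine-zeros = solve-∀

-- With θx = x∂/∂x and so on, the left-hand side is the coefficient of L F for L = 2(θx - θy) + (θx
-- - θy + θz)/x + (θx - θy - θz)/y. Since L D = 0, D · L F = L (D · F), which `defect-f` states
-- coefficientwise.
contiguity₁ : ∀ a b c →
  + 2 * (a - b) * E a b c + (a - b + c + 1ℤ) * E (a + 1ℤ) b c
    + (a - b - c - 1ℤ) * E a (b + 1ℤ) c ≡ 0ℤ
contiguity₁ = vanishing f recurrence base₁ base₂
  where
  f : Series
  f a b c = + 2 * (a - b) * E a b c + (a - b + c + 1ℤ) * E (a + 1ℤ) b c
    + (a - b - c - 1ℤ) * E a (b + 1ℤ) c
  -- The variable eijk stands for E (p + i) (q + j) (r + k).
  defect-f : ∀ p q r e000 e100 e010 e001 e110 e101 e011 e111 e200 e020 e211 e121 →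
    let F : (a b c e e₁ e₂ : ℤ) → ℤ
        F a b c e e₁ e₂ = + 2 * (a - b) * e + (a - b + c + 1ℤ) * e₁ + (a - b - c - 1ℤ) * e₂
    in F (p + 1ℤ) (q + 1ℤ) (r + 1ℤ) e111 e211 e121 - F p q (r + 1ℤ) e001 e101 e011
       - F (p + 1ℤ) q r e100 e200 e110 - F p (q + 1ℤ) r e010 e110 e020 - + 2 * F p q r e000 e100 e010
       ≡ + 2 * ((p - q) * (e111 - e001 - e100 - e010 - + 2 * e000))
         + ((p + 1ℤ) - q + r + 1ℤ) * (e211 - e101 - e200 - e110 - + 2 * e100)
         + (p - (q + 1ℤ) - r - 1ℤ) * (e121 - e011 - e110 - e020 - + 2 * e010)
  defect-f = solve-∀
  recurrence : ∀ p q r → defect f p q r ≡ 0ℤ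
  recurrence p q r = trans
    (defect-f p q r (E p q r) (E (p + 1ℤ) q r) (E p (q + 1ℤ) r) (E p q (r + 1ℤ))
      (E (p + 1ℤ) (q + 1ℤ) r) (E (p + 1ℤ) q (r + 1ℤ)) (E p (q + 1ℤ) (r + 1ℤ))
      (E (p + 1ℤ) (q + 1ℤ) (r + 1ℤ)) (E (p + 1ℤ + 1ℤ) q r) (E p (q + 1ℤ + 1ℤ) r)
      (E (p + 1ℤ + 1ℤ) (q + 1ℤ) (r + 1ℤ)) (E (p + 1ℤ) (q + 1ℤ + 1ℤ) (r + 1ℤ)))
    -- The three weights are the eigenvalues of the three θ-combinations in L, hence zero at the
    -- constant term.
    (cong₂ _+_ (cong₂ _+_
      (cong (+ 2 *_) (weighted-recurrence (λ a b c → a - b) refl p q r))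
      (weighted-recurrence (λ a b c → a - b + c + 1ℤ) refl (p + 1ℤ) q r))
      (weighted-recurrence (λ a b c → a - b - c - 1ℤ) refl p (q + 1ℤ) r))
  base₁ : ∀ n b c → f -[1+ suc n ] b c ≡ 0ℤ
  base₁ n b c = combine-zeros
    (+ 2 * (-[1+ suc n ] - b)) (-[1+ suc n ] - b + c + 1ℤ) (-[1+ suc n ] - b - c - 1ℤ)
  base₂ : ∀ a n c → f a -[1+ suc n ] c ≡ 0ℤ
  base₂ a n c rewrite E-neg₂ a (suc n) c | E-neg₂ (a + 1ℤ) (suc n) c | E-neg₂ a n c =
    combine-zeros (+ 2 * (a - -[1+ suc n ])) (a - -[1+ suc n ] + c + 1ℤ) (a - -[1+ suc n ] - c - 1ℤ)

-- Here L = 2xθx + (θx - θy + θz) + (θz - θx - θy)/y satisfies L D = 2xD, so D · (L + 2x) F = L (D ·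
-- F). The first index is shifted by one so that no `E (p + 1ℤ - 1ℤ)`, which does not reduce to
-- `E p`, enters `defect`.
contiguity₂-suc : ∀ a b c →
  + 2 * (a + 1ℤ) * E a b c + (a + 1ℤ - b + c) * E (a + 1ℤ) b c
    + (c - (a + 1ℤ) - b - 1ℤ) * E (a + 1ℤ) (b + 1ℤ) c ≡ 0ℤ
contiguity₂-suc = vanishing f recurrence base₁ base₂
  where
  f : Series
  f a b c = + 2 * (a + 1ℤ) * E a b c + (a + 1ℤ - b + c) * E (a + 1ℤ) b c
    + (c - (a + 1ℤ) - b - 1ℤ) * E (a + 1ℤ) (b + 1ℤ) c
  defect-f : ∀ p q r e000 e100 e010 e001 e110 e101 e111 e200 e210 e120 e211 e221 →
    let F : (a b c e e₁ e₂ : ℤ) → ℤ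
        F a b c e e₁ e₂ = + 2 * (a + 1ℤ) * e + (a + 1ℤ - b + c) * e₁ + (c - (a + 1ℤ) - b - 1ℤ) * e₂
    in F (p + 1ℤ) (q + 1ℤ) (r + 1ℤ) e111 e211 e221 - F p q (r + 1ℤ) e001 e101 e111
       - F (p + 1ℤ) q r e100 e200 e210 - F p (q + 1ℤ) r e010 e110 e120 - + 2 * F p q r e000 e100 e110
       ≡ + 2 * ((p + 1ℤ) * (e111 - e001 - e100 - e010 - + 2 * e000))
         + ((p + 1ℤ) - q + r + 1ℤ) * (e211 - e101 - e200 - e110 - + 2 * e100)
         + (r - (p + 1ℤ) - (q + 1ℤ) - 1ℤ) * (e221 - e111 - e210 - e120 - + 2 * e110)
  defect-f = solve-∀
  recurrence : ∀ p q r → defect f p q r ≡ 0ℤ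
  recurrence p q r = trans
    (defect-f p q r (E p q r) (E (p + 1ℤ) q r) (E p (q + 1ℤ) r) (E p q (r + 1ℤ))
      (E (p + 1ℤ) (q + 1ℤ) r) (E (p + 1ℤ) q (r + 1ℤ))
      (E (p + 1ℤ) (q + 1ℤ) (r + 1ℤ)) (E (p + 1ℤ + 1ℤ) q r)
      (E (p + 1ℤ + 1ℤ) (q + 1ℤ) r) (E (p + 1ℤ) (q + 1ℤ + 1ℤ) r)
      (E (p + 1ℤ + 1ℤ) (q + 1ℤ) (r + 1ℤ)) (E (p + 1ℤ + 1ℤ) (q + 1ℤ + 1ℤ) (r + 1ℤ)))
    (cong₂ _+_ (cong₂ _+_
      (cong (+ 2 *_) (weighted-recurrence (λ a b c → a + 1ℤ) refl p q r))
      (weighted-recurrence (λ a b c → a - b + c + 1ℤ) refl (p + 1ℤ) q r))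
      (weighted-recurrence (λ a b c → c - a - b - 1ℤ) refl (p + 1ℤ) (q + 1ℤ) r))
  base₁ : ∀ n b c → f -[1+ suc n ] b c ≡ 0ℤ
  base₁ n b c = combine-zeros
    (+ 2 * (-[1+ suc n ] + 1ℤ)) (-[1+ suc n ] + 1ℤ - b + c) (c - (-[1+ suc n ] + 1ℤ) - b - 1ℤ)
  base₂ : ∀ a n c → f a -[1+ suc n ] c ≡ 0ℤ
  base₂ a n c rewrite E-neg₂ a (suc n) c | E-neg₂ (a + 1ℤ) (suc n) c | E-neg₂ (a + 1ℤ) n c =
    combine-zeros (+ 2 * (a + 1ℤ)) (a + 1ℤ - -[1+ suc n ] + c) (c - (a + 1ℤ) - -[1+ suc n ] - 1ℤ)

contiguity₂ : ∀ a b c →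
  + 2 * a * E (a - 1ℤ) b c + (a - b + c) * E a b c + (c - a - b - 1ℤ) * E a (b + 1ℤ) c ≡ 0ℤ
contiguity₂ a b c =
  subst (λ i → + 2 * i * E (a - 1ℤ) b c + (i - b + c) * E i b c + (c - i - b - 1ℤ) * E i (b + 1ℤ) c ≡ 0ℤ)
    (trans (ℤ.+-comm (a - 1ℤ) 1ℤ) (1+[i-1]≡i a)) (contiguity₂-suc (a - 1ℤ) b c)

contiguity₃ : ∀ a b c →
  (a - b) * (a + b - c) * E a b c + a * (a - b - c - 1ℤ) * E (a - 1ℤ) b c
    + b * (a - b + c + 1ℤ) * E a (b - 1ℤ) c ≡ 0ℤ
-- The multipliers are chosen to cancel `E (a + 1ℤ) b c` and `E a (b + 1ℤ) c`; what remains is twice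
-- the claim.
contiguity₃ a b c = ℤ.*-cancelˡ-≡ (+ 2) _ 0ℤ
  (trans (eliminate a b c (E a b c) (E (a - 1ℤ) b c) (E a (b - 1ℤ) c) (E (a + 1ℤ) b c) (E a (b + 1ℤ) c))
    (combination (contiguity₁ a b c) (contiguity₂ a b c) contiguity₂ᵗ))
  where
  contiguity₂ᵗ : + 2 * b * E a (b - 1ℤ) c + (b - a + c) * E a b c + (c - b - a - 1ℤ) * E (a + 1ℤ) b c ≡ 0ℤ
  contiguity₂ᵗ rewrite E-comm a (b - 1ℤ) c | E-comm a b c | E-comm (a + 1ℤ) b c = contiguity₂ b a c
  eliminate : ∀ a b c e e₁₋ e₂₋ e₁₊ e₂₊ →
    + 2 * ((a - b) * (a + b - c) * e + a * (a - b - c - 1ℤ) * e₁₋ + b * (a - b + c + 1ℤ) * e₂₋)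
    ≡ (a + b + 1ℤ - c) * (+ 2 * (a - b) * e + (a - b + c + 1ℤ) * e₁₊ + (a - b - c - 1ℤ) * e₂₊)
      + (a - b - c - 1ℤ) * (+ 2 * a * e₁₋ + (a - b + c) * e + (c - a - b - 1ℤ) * e₂₊)
      + (a - b + c + 1ℤ) * (+ 2 * b * e₂₋ + (b - a + c) * e + (c - b - a - 1ℤ) * e₁₊)
  eliminate = solve-∀
  combination : ∀ {s t u} → s ≡ 0ℤ → t ≡ 0ℤ → u ≡ 0ℤ →
    (a + b + 1ℤ - c) * s + (a - b - c - 1ℤ) * t + (a - b + c + 1ℤ) * u ≡ 0ℤ
  combination refl refl refl = combine-zeros (a + b + 1ℤ - c) (a - b - c - 1ℤ) (a - b + c + 1ℤ)

-- The first two relations are combined so that `E a (b + 1ℤ) c` cancels.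
contiguity₄ : ∀ a b c →
  (a - b + c + 1ℤ) * (a + b - c + 1ℤ) * E (a + 1ℤ) b c
    + (+ 3 * a ^ 2 + a - (+ 2 * a + 1ℤ) * (b + c) - (b - c) ^ 2) * E a b c
    + + 2 * a * (a - b - c - 1ℤ) * E (a - 1ℤ) b c ≡ 0ℤ
contiguity₄ a b c =
  trans (eliminate a b c (E a b c) (E (a - 1ℤ) b c) (E (a + 1ℤ) b c) (E a (b + 1ℤ) c))
    (combination (contiguity₁ a b c) (contiguity₂ a b c))
  where
  -- `a * (a * 1ℤ)` is what `a ^ 2` unfolds to, so this matches the goal definitionally.
  eliminate : ∀ a b c e e₁₋ e₁₊ e₂₊ →
    (a - b + c + 1ℤ) * (a + b - c + 1ℤ) * e₁₊
      + (+ 3 * (a * (a * 1ℤ)) + a - (+ 2 * a + 1ℤ) * (b + c) - (b - c) * ((b - c) * 1ℤ)) * e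
      + + 2 * a * (a - b - c - 1ℤ) * e₁₋
    ≡ (a + b + 1ℤ - c) * (+ 2 * (a - b) * e + (a - b + c + 1ℤ) * e₁₊ + (a - b - c - 1ℤ) * e₂₊)
      + (a - b - c - 1ℤ) * (+ 2 * a * e₁₋ + (a - b + c) * e + (c - a - b - 1ℤ) * e₂₊)
  eliminate = solve-∀
  combination : ∀ {s t} → s ≡ 0ℤ → t ≡ 0ℤ → (a + b + 1ℤ - c) * s + (a - b - c - 1ℤ) * t ≡ 0ℤ
  combination refl refl = cong₂ _+_ (ℤ.*-zeroʳ (a + b + 1ℤ - c)) (ℤ.*-zeroʳ (a - b - c - 1ℤ))

mainTheorem7 : (m n k : ℕ) →
    let a = + m
        b = + n
        c = + k
    in
      (+ 2 * (a - b) * E a b c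
        + (a - b + c + 1ℤ) * E (a + 1ℤ) b c
        + (a - b - c - 1ℤ) * E a (b + 1ℤ) c ≡ 0ℤ)
    × (+ 2 * a * E (a - 1ℤ) b c
        + (a - b + c) * E a b c
        + (c - a - b - 1ℤ) * E a (b + 1ℤ) c ≡ 0ℤ)
    × ((a - b) * (a + b - c) * E a b c
        + a * (a - b - c - 1ℤ) * E (a - 1ℤ) b c
        + b * (a - b + c + 1ℤ) * E a (b - 1ℤ) c ≡ 0ℤ)
    × ((a - b + c + 1ℤ) * (a + b - c + 1ℤ) * E (a + 1ℤ) b c
        + (+ 3 * a ^ 2 + a - (+ 2 * a + 1ℤ) * (b + c) - (b - c) ^ 2) * E a b c
        + + 2 * a * (a - b - c - 1ℤ) * E (a - 1ℤ) b c ≡ 0ℤ)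
mainTheorem7 m n k =
  contiguity₁ (+ m) (+ n) (+ k) , contiguity₂ (+ m) (+ n) (+ k) ,
  contiguity₃ (+ m) (+ n) (+ k) , contiguity₄ (+ m) (+ n) (+ k)
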